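{- For any sequence $\mathbf{s}=(s_1,s_2,\ldots)$ of positive integers and any $n\ge 1$, the polynomial $Q_n^{(\mathbf{s})}(x)$ is unimodal.
   Context: For a sequence $\mathbf{s}$ of positive integers and $n\ge1$, let $\mathbf{v}_i=(0,\ldots,0,s_i,s_{i+1},\ldots,s_n)\in\mathbb{R}^n$ (first $i-1$ coordinates zero) for $1\le i\le n$, and let $\Pi_n^{(\mathbf{s})}=\left\{\sum_{i=1}^n\alpha_i\mathbf{v}_i \mid 0\le\alpha_i<1\right\}$. The $n$th inflated $\mathbf{s}$-Eulerian polynomial is $$Q_n^{(\mathbf{s})}(x)=\sum_{\lambda\in\Pi_n^{(\mathbf{s})}\cap\mathbb{Z}^n}x^{\lambda_n}.$$ A sequence $(a_0,a_1,\ldots,a_d)$ is unimodal if there is an integer $0\le t\le d$ such that $a_0\le a_1\le\cdots\le a_t>a_{t+1}\ge a_{t+2}\ge\cdots\ge a_d$ (with $t=d$ allowed). A polynomial $\sum_{k=0}^d a_kx^k$ of degree $d$ is unimodal if its sequence of coefficients $(a_0,a_1,\ldots,a_d)$ is unimodal. -}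

module Defs where

open import Data.Bool.Base using (if_then_else_)
open import Data.Fin.Base using (Fin; zero; suc; toℕ)
open import Data.Fin.Properties using (all?)
open import Data.Integer.Base as ℤ using (ℤ; +_; -[1+_]; ∣_∣)
import Data.Integer.Properties as ℤ
open import Data.List.Base using (List; []; _∷_; _++_; map; foldr; filter;
  replicate; upTo; cartesianProductWith)
open import Data.List.Membership.Propositional using (_∈_)
open import Data.List.Membership.Propositional.Properties
  using (∈-filter⁺; ∈-filter⁻; ∈-cartesianProductWith⁺; ∈-map⁺; ∈-upTo⁺)
open import Data.List.Relation.Unary.All using ([])
open import Data.List.Relation.Unary.Any using (here)
open import Data.List.Relation.Unary.AllPairs using ([]; _∷_)
open import Data.List.Relation.Unary.Unique.Propositional using (Unique)
import Data.List.Relation.Unary.Unique.Propositional.Properties as Unique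
open import Data.Nat.Base as ℕ using (ℕ; zero; suc; _<ᵇ_; z≤n; s≤s)
import Data.Nat.Properties as ℕ
open import Data.Product.Base using (∃; _×_; _,_; proj₁; proj₂)
open import Data.Rational.Base using (ℚ; 0ℚ; 1ℚ; _+_; _*_; _-_;
  -_; _≤_; _<_; *≤*; 1/_; nonNegative; +-0-rawMonoid)
open import Data.Rational.Literals using (fromℤ)
open import Data.Rational.Properties as ℚ using (toℚᵘ-injective; drop-*≤*)
import Data.Rational.Unnormalised.Base as ℚᵘ
import Data.Rational.Unnormalised.Properties as ℚᵘ
open import Data.Vec.Base as Vec using (Vec; []; _∷_; lookup; last)
open import Data.Vec.Functional using (Vector)
open import Data.Vec.Properties using (∷-injective)
open import Function.Base using (_∘_)
open import Relation.Binary.PropositionalEquality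
open import Relation.Nullary using (Dec)
open import Relation.Nullary.Decidable using (map′; _×-dec_)
open import Algebra.Definitions.RawMonoid +-0-rawMonoid using (sum)

------------------------------------------------------------------------
-- Polynomials with natural-number coefficients

-- A polynomial is its list of coefficients, constant term first.
-- Trailing zeros are allowed, so lists are compared through coeff only.

Poly : Set
Poly = List ℕ

coeff : Poly → ℕ → ℕ
coeff []      _       = 0
coeff (a ∷ p) zero    = a
coeff (a ∷ p) (suc k) = coeff p k

infixl 6 _⊕_

_⊕_ : Poly → Poly → Poly
[]      ⊕ q       = q
(a ∷ p) ⊕ []      = a ∷ p
(a ∷ p) ⊕ (b ∷ q) = (a ℕ.+ b) ∷ (p ⊕ q)

x^_ : ℕ → Poly
x^ k = replicate k 0 ++ (1 ∷ [])

HasDegree : Poly → ℕ → Set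
HasDegree p d = coeff p d ≢ 0 × (∀ k → d ℕ.< k → coeff p k ≡ 0)

-- Unimodality of the finite sequence (a 0, …, a d); the values of a
-- beyond d play no role.

UnimodalSeq : (d : ℕ) → (ℕ → ℕ) → Set
UnimodalSeq d a = ∃ λ t →
    t ℕ.≤ d
  × (∀ i → i ℕ.< t → a i ℕ.≤ a (suc i))
  × (t ℕ.< d → a t ℕ.> a (suc t))
  × (∀ i → t ℕ.< i → i ℕ.< d → a i ℕ.≥ a (suc i))

Unimodal : Poly → Set
Unimodal p = ∃ λ d → HasDegree p d × UnimodalSeq d (coeff p)

------------------------------------------------------------------------
-- The parallelepiped and its lattice points

-- Indices are shifted by one: s i stands for s_{i+1}.  So for
-- i, j : Fin n, v s i j is the coordinate number j+1 of v_{i+1}.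

v : (ℕ → ℕ) → ∀ {n} → Fin n → Vector ℚ n
v s i j = if toℕ j <ᵇ toℕ i then 0ℚ else fromℤ (+ s (toℕ j))

-- The scalars range over ℚ instead of ℝ.  This does not change the
-- lattice points: the vectors v_1, …, v_n are integral and, s being
-- positive, linearly independent, so the real coordinates of an integer
-- vector with respect to them are rational.

InΠ : (ℕ → ℕ) → ∀ {n} → Vector ℚ n → Set
InΠ s {n} x = ∃ λ (α : Vector ℚ n) →
    (∀ i → 0ℚ ≤ α i × α i < 1ℚ)
  × (∀ j → x j ≡ sum (λ i → α i * v s i j))

LatticePoint : (ℕ → ℕ) → ∀ {n} → Vec ℤ n → Set
LatticePoint s l = InΠ s (fromℤ ∘ lookup l)

-- A duplicate-free list of exactly the elements satisfying P, making
-- finite sums over P meaningful.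

record Enumeration {A : Set} (P : A → Set) : Set where
  field
    elements : List A
    unique   : Unique elements
    sound    : ∀ {x} → x ∈ elements → P x
    complete : ∀ {x} → P x → x ∈ elements

------------------------------------------------------------------------
-- Finiteness of the set of lattice points.  Coordinate j of
-- Σ αᵢ vᵢ is s j * (α₀ + ⋯ + αⱼ), which bounds the coordinates of a
-- lattice point and determines its α.

prefix : ∀ {n} → Vector ℚ n → Vector ℚ n
prefix α zero    = α zero
prefix α (suc j) = α zero + prefix (α ∘ suc) j

sum-zero : ∀ {n} (α : Vector ℚ n) → sum (λ i → α i * 0ℚ) ≡ 0ℚ
sum-zero {zero}  α = refl
sum-zero {suc n} α = cong₂ _+_ (ℚ.*-zeroʳ (α zero)) (sum-zero (α ∘ suc))

sum-v : ∀ s {n} (α : Vector ℚ n) j →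
        sum (λ i → α i * v s i j) ≡ prefix α j * fromℤ (+ s (toℕ j))
sum-v s α zero =
  trans (cong (λ y → α zero * fromℤ (+ s 0) + y) (sum-zero (α ∘ suc)))
        (ℚ.+-identityʳ _)
sum-v s α (suc j) =
  trans (cong (λ y → α zero * c + y) (sum-v (s ∘ suc) (α ∘ suc) j))
        (sym (ℚ.*-distribʳ-+ c (α zero) (prefix (α ∘ suc) j)))
  where c = fromℤ (+ s (suc (toℕ j)))

fromℤ-+ : ∀ a b → fromℤ a + fromℤ b ≡ fromℤ (a ℤ.+ b)
fromℤ-+ a b = toℚᵘ-injective (ℚᵘ.≃-trans (ℚ.toℚᵘ-homo-+ (fromℤ a) (fromℤ b))
  (ℚᵘ.*≡* (cong (ℤ._* + 1)
    (cong₂ ℤ._+_ (ℤ.*-identityʳ a) (ℤ.*-identityʳ b)))))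

fromℤ-* : ∀ a b → fromℤ a * fromℤ b ≡ fromℤ (a ℤ.* b)
fromℤ-* a b = toℚᵘ-injective (ℚᵘ.≃-trans (ℚ.toℚᵘ-homo-* (fromℤ a) (fromℤ b))
  (ℚᵘ.*≡* refl))

fromℤ-cancel-≤ : ∀ {a b} → fromℤ a ≤ fromℤ b → a ℤ.≤ b
fromℤ-cancel-≤ {a} {b} p =
  subst₂ ℤ._≤_ (ℤ.*-identityʳ a) (ℤ.*-identityʳ b) (drop-*≤* p)

prefix-bounds : ∀ {n} (α : Vector ℚ n) → (∀ i → 0ℚ ≤ α i × α i < 1ℚ) →
                ∀ j → 0ℚ ≤ prefix α j × prefix α j ≤ fromℤ (+ suc (toℕ j))
prefix-bounds α b zero = proj₁ (b zero) , ℚ.<⇒≤ (proj₂ (b zero))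
prefix-bounds α b (suc j) with prefix-bounds (α ∘ suc) (b ∘ suc) j
... | lo , hi =
    ℚ.+-mono-≤ (proj₁ (b zero)) lo
  , subst (prefix α (suc j) ≤_) (fromℤ-+ (+ 1) (+ suc (toℕ j)))
      (ℚ.+-mono-≤ (ℚ.<⇒≤ (proj₂ (b zero))) hi)

lattice-bounds : ∀ s {n} {l : Vec ℤ n} → LatticePoint s l → ∀ j →
  + 0 ℤ.≤ lookup l j × lookup l j ℤ.≤ + (suc (toℕ j) ℕ.* s (toℕ j))
lattice-bounds s {l = l} (α , b , e) j with prefix-bounds α b j
... | lo , hi =
    fromℤ-cancel-≤ (subst₂ _≤_ (ℚ.*-zeroˡ c) (sym eq) (mono lo))
  , fromℤ-cancel-≤ (subst₂ _≤_ (sym eq)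
      (trans (fromℤ-* (+ suc (toℕ j)) (+ s (toℕ j)))
             (cong fromℤ (sym (ℤ.pos-* (suc (toℕ j)) (s (toℕ j))))))
      (mono hi))
  where
  c = fromℤ (+ s (toℕ j))
  eq : fromℤ (lookup l j) ≡ prefix α j * c
  eq = trans (e j) (sum-v s α j)
  c≥0 : 0ℚ ≤ c
  c≥0 = *≤* (subst (+ 0 ℤ.≤_) (sym (ℤ.*-identityʳ (+ s (toℕ j)))) (ℤ.+≤+ z≤n))
  mono : ∀ {p q} → p ≤ q → p * c ≤ q * c
  mono = ℚ.*-monoʳ-≤-nonNeg c {{nonNegative c≥0}}

-- diff p A is the sequence of increments of p, A 0, A 1, …

diff : ∀ {n} → ℚ → Vector ℚ n → Vector ℚ n
diff p A zero    = A zero - p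
diff p A (suc j) = diff (A zero) (A ∘ suc) j

p+[q-p]≡q : ∀ p q → p + (q - p) ≡ q
p+[q-p]≡q p q = trans (cong (λ y → p + y) (ℚ.+-comm q (- p)))
  (trans (sym (ℚ.+-assoc p (- p) q))
  (trans (cong (_+ q) (ℚ.+-inverseʳ p)) (ℚ.+-identityˡ q)))

prefix-diff : ∀ {n} p (A : Vector ℚ n) j → p + prefix (diff p A) j ≡ A j
prefix-diff p A zero = p+[q-p]≡q p (A zero)
prefix-diff p A (suc j) =
  trans (sym (ℚ.+-assoc p _ _))
  (trans (cong (_+ prefix (diff (A zero) (A ∘ suc)) j) (p+[q-p]≡q p (A zero)))
         (prefix-diff (A zero) (A ∘ suc) j))

diff-unique : ∀ {n} p (A α : Vector ℚ n) → (∀ j → p + prefix α j ≡ A j) →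
              ∀ i → α i ≡ diff p A i
diff-unique p A α e zero =
  trans (sym (trans (cong (_- p) (ℚ.+-comm p (α zero)))
    (trans (ℚ.+-assoc (α zero) p (- p))
    (trans (cong (λ y → α zero + y) (ℚ.+-inverseʳ p))
           (ℚ.+-identityʳ (α zero))))))
  (cong (_- p) (e zero))
diff-unique p A α e (suc i) = diff-unique (A zero) (A ∘ suc) (α ∘ suc)
  (λ j → trans (cong (_+ prefix (α ∘ suc) j) (sym (e zero)))
               (trans (ℚ.+-assoc p (α zero) _) (e (suc j)))) i

reciprocal : ∀ m → 0 ℕ.< m → ∃ λ c → fromℤ (+ m) * c ≡ 1ℚ
reciprocal (suc m) _ = 1/ fromℤ (+ suc m) , ℚ.*-inverseʳ (fromℤ (+ suc m))

latticePoint? : ∀ s → (∀ i → 0 ℕ.< s i) → ∀ {n} (l : Vec ℤ n) →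
                Dec (LatticePoint s l)
latticePoint? s pos {n} l = map′ to from
  (all? λ i → (0ℚ ℚ.≤? α₀ i) ×-dec (α₀ i ℚ.<? 1ℚ))
  where
  S c A α₀ : Vector ℚ n
  S j  = fromℤ (+ s (toℕ j))
  c j  = proj₁ (reciprocal (s (toℕ j)) (pos (toℕ j)))
  A j  = fromℤ (lookup l j) * c j
  α₀   = diff 0ℚ A

  Sc≡1 : ∀ j → S j * c j ≡ 1ℚ
  Sc≡1 j = proj₂ (reciprocal (s (toℕ j)) (pos (toℕ j)))

  AS≡l : ∀ j → A j * S j ≡ fromℤ (lookup l j)
  AS≡l j = trans (ℚ.*-assoc x (c j) (S j))
    (trans (cong (λ y → x * y) (trans (ℚ.*-comm (c j) (S j)) (Sc≡1 j)))
           (ℚ.*-identityʳ x))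
    where x = fromℤ (lookup l j)

  to : (∀ i → 0ℚ ≤ α₀ i × α₀ i < 1ℚ) → LatticePoint s l
  to b = α₀ , b , λ j → sym (trans (sum-v s α₀ j)
    (trans (cong (_* S j)
      (trans (sym (ℚ.+-identityˡ (prefix α₀ j))) (prefix-diff 0ℚ A j))) (AS≡l j)))

  from : LatticePoint s l → ∀ i → 0ℚ ≤ α₀ i × α₀ i < 1ℚ
  from (α , b , e) i = subst (λ y → 0ℚ ≤ y × y < 1ℚ)
    (diff-unique 0ℚ A α
      (λ j → trans (ℚ.+-identityˡ (prefix α j)) (sym (A≡ j))) i) (b i)
    where
    A≡ : ∀ j → A j ≡ prefix α j
    A≡ j = trans (cong (_* c j) (trans (e j) (sum-v s α j)))
      (trans (ℚ.*-assoc (prefix α j) (S j) (c j))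
      (trans (cong (λ y → prefix α j * y) (Sc≡1 j)) (ℚ.*-identityʳ _)))

box : ∀ {n} → (Fin n → ℕ) → List (Vec ℤ n)
box {zero}  b = [] ∷ []
box {suc n} b =
  cartesianProductWith _∷_ (map +_ (upTo (suc (b zero)))) (box (b ∘ suc))

box-unique : ∀ {n} (b : Fin n → ℕ) → Unique (box b)
box-unique {zero}  b = [] ∷ []
box-unique {suc n} b = Unique.cartesianProductWith⁺ _∷_ ∷-injective
  (Unique.map⁺ ℤ.+-injective (Unique.upTo⁺ (suc (b zero)))) (box-unique (b ∘ suc))

box-complete : ∀ {n} (b : Fin n → ℕ) (l : Vec ℤ n) →
  (∀ j → + 0 ℤ.≤ lookup l j × lookup l j ℤ.≤ + b j) → l ∈ box b
box-complete b []            h = here refl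
box-complete b (+ x ∷ l)     h = ∈-cartesianProductWith⁺ _∷_
  (∈-map⁺ +_ (∈-upTo⁺ {n = suc (b zero)} (s≤s (ℤ.drop‿+≤+ (proj₂ (h zero))))))
  (box-complete (b ∘ suc) l (h ∘ suc))
box-complete b (-[1+ x ] ∷ l) h with proj₁ (h zero)
... | ()

latticePoints : ∀ s → (∀ i → 0 ℕ.< s i) → ∀ n →
                Enumeration (LatticePoint s {n})
latticePoints s pos n = record
  { elements = filter P? candidates
  ; unique   = Unique.filter⁺ P? (box-unique bound)
  ; sound    = λ m → proj₂ (∈-filter⁻ P? {xs = candidates} m)
  ; complete = λ {l} h → ∈-filter⁺ P? (box-complete bound l (lattice-bounds s {l = l} h)) h
  }
  where
  P? = latticePoint? s pos {n}
  bound : Fin n → ℕ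
  bound j = suc (toℕ j) ℕ.* s (toℕ j)
  candidates = box bound

------------------------------------------------------------------------
-- The inflated s-Eulerian polynomials

-- By lattice-bounds the last coordinate of a lattice point is
-- nonnegative, so the absolute value only converts it to a natural
-- number.

Q : ∀ s → (∀ i → 0 ℕ.< s i) → (n : ℕ) → .{{ℕ.NonZero n}} → Poly
Q s pos (suc m) =
  foldr _⊕_ []
    (map (λ l → x^ ∣ last l ∣) (elements (latticePoints s pos (suc m))))
  where open Enumeration

{-# OPTIONS --safe #-}
-- A point λ lies in Π_n iff 0 ≤ λ_j/s_j − λ_{j−1}/s_{j−1} < 1 for all j
-- (with λ_0/s_0 = 0/1).  Hence, writing q_j(k) for the number of points of Π_j with last
-- coordinate k, and f(k) = ⌊k s_{j−1}/s_j⌋,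
--   q_j(k) = Σ q_{j−1}(x)  over  f(k) − s_{j−1} < x ≤ f(k).
-- Sums over windows of fixed length preserve quasi-concavity
-- (a_j ≥ min(a_i, a_k) for i ≤ j ≤ k), and so does reindexing along the
-- monotone map f; starting from q_0 = (1,0,0,…), every q_j is
-- quasi-concave, which for finite sequences amounts to unimodality.

module Submission where

open import Defs
open import Data.Nat.Base using (ℕ; _<_; NonZero)

open import Data.Fin.Base using (zero; suc; toℕ)
import Data.Integer.Base as ℤ
import Data.Integer.Properties as ℤ
open import Data.List.Base as List using (List; []; _∷_; _++_; length; foldr; filter)
open import Data.List.Membership.Propositional using (_∈_)
open import Data.List.Membership.Propositional.Properties
  using (∈-++⁺ˡ; ∈-++⁺ʳ; ∈-++⁻; ∈-map⁺; ∈-map⁻; ∈-filter⁺; ∈-filter⁻; ∈-length)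
open import Data.List.Membership.Propositional.Properties.WithK using (unique∧set⇒bag)
open import Data.List.Properties using (length-++; length-map; filter-accept; filter-reject)
open import Data.List.Relation.Binary.BagAndSetEquality using (∼bag⇒↭)
open import Data.List.Relation.Binary.Disjoint.Propositional using (Disjoint)
open import Data.List.Relation.Binary.Permutation.Propositional.Properties using (↭-length)
open import Data.List.Relation.Unary.All using ([])
open import Data.List.Relation.Unary.AllPairs using ([]; _∷_)
open import Data.List.Relation.Unary.Any using (here)
open import Data.List.Relation.Unary.Unique.Propositional using (Unique)
import Data.List.Relation.Unary.Unique.Propositional.Properties as Unique
open import Data.Nat.Base using (zero; suc; _+_; _*_; _≤_; z≤n; s≤s; z<s; _/_; >-nonZero; >-nonZero⁻¹)
open import Data.Nat.DivMod using (m/n*n≤m; /-monoˡ-≤; m<n*o⇒m/o<n; m*n/n≡m; m≡m%n+[m/n]*n; m%n<n)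
open import Data.Nat.Properties
open import Data.Product.Base using (∃; _×_; _,_; proj₁; proj₂)
open import Data.Rational.Base as ℚ using (ℚ; 0ℚ; 1ℚ)
open import Data.Rational.Literals using (fromℤ)
import Data.Rational.Properties as ℚ
open import Data.Sum.Base using (_⊎_; inj₁; inj₂)
open import Data.Unit.Base using (⊤; tt)
open import Data.Vec.Base as Vec using (Vec; []; _∷_; _∷ʳ_; lookup; last; initLast; replicate)
import Data.Vec.Functional as F
import Data.Vec.Properties as Vec
open import Function.Base using (_∘_)
open import Function.Bundles using (mk⇔)
open import Relation.Binary.PropositionalEquality
open import Relation.Nullary using (yes; no; contradiction)

-- Quasi-concave sequences

QuasiConcave : (ℕ → ℕ) → Set
QuasiConcave a = ∀ {i j k} → i ≤ j → j ≤ k → a i ≤ a j ⊎ a k ≤ a j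

quasiConcave-cong : ∀ {a b} → (∀ k → a k ≡ b k) → QuasiConcave a → QuasiConcave b
quasiConcave-cong e qc {i} {j} {k} i≤j j≤k
  rewrite sym (e i) | sym (e j) | sym (e k) = qc i≤j j≤k

quasiConcave-∘ : ∀ {a f} → (∀ {i j} → i ≤ j → f i ≤ f j) →
                 QuasiConcave a → QuasiConcave (a ∘ f)
quasiConcave-∘ mono qc i≤j j≤k = qc (mono i≤j) (mono j≤k)

antitone-from : ∀ {a : ℕ → ℕ} {j} → (∀ {u} → j ≤ u → a (suc u) ≤ a u) →
                ∀ {k} → j ≤ k → a k ≤ a j
antitone-from {a} {j} h {k} j≤k with m≤n⇒m<n∨m≡n j≤k
... | inj₂ refl = ≤-refl
antitone-from {a} {j} h {suc k} _ | inj₁ (s≤s j≤k) =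
  ≤-trans (h j≤k) (antitone-from {a} h j≤k)

-- Induction on `j`: as long as no strict descent has occurred, `a j` dominates everything before
-- it; the first strict descent makes the sequence antitone from there on. Either alternative yields
-- one of the two inequalities at `j`.
descents-persist⇒quasiConcave : ∀ {a} →
  (∀ {t u} → t ≤ u → a (suc t) < a t → a (suc u) ≤ a u) → QuasiConcave a
descents-persist⇒quasiConcave {a} persist {i} {j} i≤j j≤k with dichotomy j
  where
  dichotomy : ∀ j → (∀ {i} → i ≤ j → a i ≤ a j) ⊎ (∀ {u} → j ≤ u → a (suc u) ≤ a u)
  dichotomy zero = inj₁ λ where z≤n → ≤-refl
  dichotomy (suc j) with dichotomy j
  ... | inj₂ down = inj₂ λ j<u → down (<⇒≤ j<u)
  ... | inj₁ up with a j ≤? a (suc j)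
  ...   | no  aj≰ = inj₂ λ j<u → persist (<⇒≤ j<u) (≰⇒> aj≰)
  ...   | yes aj≤ = inj₁ below
    where
    below : ∀ {i} → i ≤ suc j → a i ≤ a (suc j)
    below i≤ with m≤n⇒m<n∨m≡n i≤
    ... | inj₁ (s≤s i≤j) = ≤-trans (up i≤j) aj≤
    ... | inj₂ refl      = ≤-refl
... | inj₁ up   = inj₁ (up i≤j)
... | inj₂ down = inj₂ (antitone-from {a} down j≤k)

-- Padded sequences and window sums

pad : ∀ {A : Set} → A → ℕ → (ℕ → A) → ℕ → A
pad z zero    g j       = g j
pad z (suc c) g zero    = z
pad z (suc c) g (suc j) = pad z c g j

pad-+ : ∀ {A : Set} (z : A) c g x → pad z c g (c + x) ≡ g x
pad-+ z zero    g x = refl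
pad-+ z (suc c) g x = pad-+ z c g x

pad-∘ : ∀ {A B : Set} (h : A → B) z c g j → h (pad z c g j) ≡ pad (h z) c (h ∘ g) j
pad-∘ h z zero    g j       = refl
pad-∘ h z (suc c) g zero    = refl
pad-∘ h z (suc c) g (suc j) = pad-∘ h z c g j

-- Zero is the least natural number, so a padding entry on the left lies below every other value;
-- past the padding the claim is the one for `a`.
quasiConcave-pad : ∀ c {a} → QuasiConcave a → QuasiConcave (pad 0 c a)
quasiConcave-pad zero    qc i≤j       j≤k       = qc i≤j j≤k
quasiConcave-pad (suc c) qc z≤n       _         = inj₁ z≤n
quasiConcave-pad (suc c) qc (s≤s i≤j) (s≤s j≤k) = quasiConcave-pad c qc i≤j j≤k

windowSum : (ℕ → ℕ) → ℕ → ℕ → ℕ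
windowSum p t zero    = 0
windowSum p t (suc c) = p t + windowSum p (suc t) c

windowSum-cong : ∀ {p q} → (∀ j → p j ≡ q j) → ∀ t c → windowSum p t c ≡ windowSum q t c
windowSum-cong e t zero    = refl
windowSum-cong e t (suc c) = cong₂ _+_ (e t) (windowSum-cong e (suc t) c)

-- Both sides sum `p` over the indices from `t` to `t + c`, which compares consecutive windows
-- without subtraction.
windowSum-slide : ∀ p t c → windowSum p t c + p (t + c) ≡ p t + windowSum p (suc t) c
windowSum-slide p t zero    = trans (cong p (+-identityʳ t)) (sym (+-identityʳ (p t)))
windowSum-slide p t (suc c) = begin
  p t + windowSum p (suc t) c + p (t + suc c)   ≡⟨ +-assoc (p t) _ _ ⟩
  p t + (windowSum p (suc t) c + p (t + suc c)) ≡⟨ cong (λ j → p t + (windowSum p (suc t) c + p j)) (+-suc t c) ⟩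
  p t + (windowSum p (suc t) c + p (suc t + c)) ≡⟨ cong (p t +_) (windowSum-slide p (suc t) c) ⟩
  p t + windowSum p (suc t) (suc c)             ∎
  where open ≡-Reasoning

-- Sliding the window one place trades `p t` for `p (t + c)`, so a strict descent means that the
-- entering value is below the leaving one. By `ends-persist` this cannot be reversed further right.
quasiConcave-windowSum : ∀ {p} c → QuasiConcave p → QuasiConcave (λ t → windowSum p t c)
quasiConcave-windowSum {p} c qc =
  descents-persist⇒quasiConcave λ t≤u down → step-down (ends-persist t≤u (ends-down down))
  where
  W : ℕ → ℕ
  W t = windowSum p t c

  -- By windowSum-slide, W t ≤ W (suc t) exactly when p t ≤ p (t + c).
  ends-down : ∀ {t} → W (suc t) < W t → p (t + c) < p t
  ends-down {t} down = ≰⇒> λ up → <⇒≱ down (+-cancelˡ-≤ (p t) _ _ (begin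
    p t + W t       ≡⟨ +-comm (p t) (W t) ⟩
    W t + p t       ≤⟨ +-monoʳ-≤ (W t) up ⟩
    W t + p (t + c) ≡⟨ windowSum-slide p t c ⟩
    p t + W (suc t) ∎))
    where open ≤-Reasoning

  step-down : ∀ {t} → p (t + c) ≤ p t → W (suc t) ≤ W t
  step-down {t} down = +-cancelˡ-≤ (p t) _ _ (begin
    p t + W (suc t) ≡⟨ windowSum-slide p t c ⟨
    W t + p (t + c) ≤⟨ +-monoʳ-≤ (W t) down ⟩
    W t + p t       ≡⟨ +-comm (W t) (p t) ⟩
    p t + W t       ∎)
    where open ≤-Reasoning

  ends-persist : ∀ {t u} → t ≤ u → p (t + c) < p t → p (u + c) ≤ p u
  -- First `u` is placed between `t` and `u + c`, then `t + c` between the same two indices. The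
  -- last case is the chain `p (u + c) ≤ p (t + c) < p t ≤ p u`.
  ends-persist {t} {u} t≤u down with qc t≤u (m≤m+n u c)
  ... | inj₂ le = le
  ... | inj₁ pt≤pu with qc (m≤m+n t c) (+-monoˡ-≤ c t≤u)
  ...   | inj₁ up = contradiction up (<⇒≱ down)
  ...   | inj₂ le = ≤-trans le (≤-trans (<⇒≤ down) pt≤pu)

-- Unimodality from the last maximum

last-argmax : ∀ (a : ℕ → ℕ) d → ∃ λ t → t ≤ d × (∀ {i} → i ≤ t → a i ≤ a t) ×
              (∀ {i} → t < i → i ≤ d → a i < a t)
last-argmax a zero = 0 , z≤n , (λ where z≤n → ≤-refl) , λ t<i i≤0 → contradiction i≤0 (<⇒≱ t<i)
last-argmax a (suc d) with last-argmax a d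
... | t , t≤d , before , after with a t ≤? a (suc d)
...   | no at≰ = t , m≤n⇒m≤1+n t≤d , before , after′
  where
  after′ : ∀ {i} → t < i → i ≤ suc d → a i < a t
  after′ t<i i≤ with m≤n⇒m<n∨m≡n i≤
  ... | inj₁ (s≤s i≤d) = after t<i i≤d
  ... | inj₂ refl      = ≰⇒> at≰
-- A tie also moves the maximum, so that later values are always strictly smaller.
...   | yes at≤ = suc d , ≤-refl , before′ , λ d<i i≤d → contradiction i≤d (<⇒≱ d<i)
  where
  before′ : ∀ {i} → i ≤ suc d → a i ≤ a (suc d)
  before′ {i} i≤ with m≤n⇒m<n∨m≡n i≤ | i ≤? t
  ... | inj₂ refl      | _       = ≤-refl
  ... | inj₁ _         | yes i≤t = ≤-trans (before i≤t) at≤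
  ... | inj₁ (s≤s i≤d) | no i≰t  = ≤-trans (<⇒≤ (after (≰⇒> i≰t) i≤d)) at≤

-- The peak is the last maximum up to `d`. Its strict dominance over later values gives the strict
-- drop right after it, and excludes `a t ≤ a i` when quasi-concavity is applied to `t < i < suc i`.
quasiConcave⇒unimodalSeq : ∀ {a} → QuasiConcave a → ∀ d → UnimodalSeq d a
quasiConcave⇒unimodalSeq {a} qc d with last-argmax a d
... | t , t≤d , before , after = t , t≤d , rising , after ≤-refl , falling
  where
  rising : ∀ i → i < t → a i ≤ a (suc i)
  rising i i<t with qc (n≤1+n i) i<t
  ... | inj₁ le = le
  ... | inj₂ le = ≤-trans (before (<⇒≤ i<t)) le

  falling : ∀ i → t < i → i < d → a (suc i) ≤ a i
  falling i t<i i<d with qc (<⇒≤ t<i) (n≤1+n i)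
  ... | inj₁ le = contradiction le (<⇒≱ (after t<i (<⇒≤ i<d)))
  ... | inj₂ le = le

-- Coefficients

coeff-length : ∀ p {k} → length p ≤ k → coeff p k ≡ 0
coeff-length []      _         = refl
coeff-length (a ∷ p) (s≤s p≤k) = coeff-length p p≤k

-- Trailing zeros make `length p` a mere bound on the degree. The search descends from it to the
-- last nonzero coefficient; the one at `k` keeps it from running out.
hasDegree : ∀ p {k} → coeff p k ≢ 0 → ∃ (HasDegree p)
hasDegree p {k} nz = search (length p) λ _ → coeff-length p
  where
  search : ∀ N → (∀ k → N ≤ k → coeff p k ≡ 0) → ∃ (HasDegree p)
  search zero    vanish = contradiction (vanish k z≤n) nz
  search (suc N) vanish with coeff p N ≟ 0
  ... | no  aN≢0 = N , aN≢0 , vanish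
  ... | yes aN≡0 = search N vanish′
    where
    vanish′ : ∀ k → N ≤ k → coeff p k ≡ 0
    vanish′ k N≤k with m≤n⇒m<n∨m≡n N≤k
    ... | inj₁ N<k  = vanish k N<k
    ... | inj₂ refl = aN≡0

coeff-⊕ : ∀ p q k → coeff (p ⊕ q) k ≡ coeff p k + coeff q k
coeff-⊕ []      q       k       = refl
coeff-⊕ (a ∷ p) []      k       = sym (+-identityʳ _)
coeff-⊕ (a ∷ p) (b ∷ q) zero    = refl
coeff-⊕ (a ∷ p) (b ∷ q) (suc k) = coeff-⊕ p q k

coeff-x^-≡ : ∀ m → coeff (x^ m) m ≡ 1
coeff-x^-≡ zero    = refl
coeff-x^-≡ (suc m) = coeff-x^-≡ m

coeff-x^-≢ : ∀ {m k} → m ≢ k → coeff (x^ m) k ≡ 0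
coeff-x^-≢ {zero}  {zero}  m≢k = contradiction refl m≢k
coeff-x^-≢ {zero}  {suc k} m≢k = refl
coeff-x^-≢ {suc m} {zero}  m≢k = refl
coeff-x^-≢ {suc m} {suc k} m≢k = coeff-x^-≢ (m≢k ∘ cong suc)

coeff-sum-x^ : ∀ {A : Set} (g : A → ℕ) k xs →
  coeff (foldr _⊕_ [] (List.map (λ x → x^ g x) xs)) k ≡
  length (filter (λ x → g x ≟ k) xs)
coeff-sum-x^ g k [] = refl
coeff-sum-x^ g k (x ∷ xs)
  rewrite coeff-⊕ (x^ g x) (foldr _⊕_ [] (List.map (λ x → x^ g x) xs)) k
        | coeff-sum-x^ g k xs
  with g x ≟ k
... | yes refl rewrite coeff-x^-≡ (g x)
                     | filter-accept (λ y → g y ≟ g x) {xs = xs} (refl {x = g x}) = refl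
... | no ne    rewrite coeff-x^-≢ ne
                     | filter-reject (λ y → g y ≟ k) {xs = xs} ne = refl

-- Lattice points as chains

-- The condition 0 ≤ y/d − x/c < 1, cleared of denominators.
Step : (c x d y : ℕ) → Set
Step c x d y = x * d ≤ y * c × y * c < (x + c) * d

-- `c` and `x` are the preceding scale and coordinate, so that a tail is again a chain for the
-- shifted sequence. Starting from `1` and `0` encodes λ_0/s_0 = 0/1.
Chain : (ℕ → ℕ) → (c x : ℕ) → ∀ {n} → Vec ℕ n → Set
Chain s c x []      = ⊤
Chain s c x (y ∷ l) = Step c x (s 0) y × Chain (s ∘ suc) (s 0) y l

ℚ-<⇒≱ : ∀ {p q : ℚ} → p ℚ.< q → p ℚ.≱ q
ℚ-<⇒≱ p<q q≤p = ℚ.<-irrefl refl (ℚ.<-≤-trans p<q q≤p)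

fromℕ : ℕ → ℚ
fromℕ n = fromℤ (ℤ.+ n)

fromℕ-+ : ∀ m n → fromℕ (m + n) ≡ fromℕ m ℚ.+ fromℕ n
fromℕ-+ m n = sym (fromℤ-+ (ℤ.+ m) (ℤ.+ n))

fromℕ-* : ∀ m n → fromℕ (m * n) ≡ fromℕ m ℚ.* fromℕ n
fromℕ-* m n = trans (cong fromℤ (ℤ.pos-* m n)) (sym (fromℤ-* (ℤ.+ m) (ℤ.+ n)))

fromℕ-mono-≤ : ∀ {m n} → m ≤ n → fromℕ m ℚ.≤ fromℕ n
fromℕ-mono-≤ {m} {n} m≤n = ℚ.*≤* (subst₂ ℤ._≤_
  (sym (ℤ.*-identityʳ (ℤ.+ m))) (sym (ℤ.*-identityʳ (ℤ.+ n))) (ℤ.+≤+ m≤n))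

fromℕ-cancel-≤ : ∀ {m n} → fromℕ m ℚ.≤ fromℕ n → m ≤ n
fromℕ-cancel-≤ le = ℤ.drop‿+≤+ (fromℤ-cancel-≤ le)

fromℕ-mono-< : ∀ {m n} → m < n → fromℕ m ℚ.< fromℕ n
fromℕ-mono-< m<n = ℚ.≰⇒> (<⇒≱ m<n ∘ fromℕ-cancel-≤)

fromℕ-cancel-< : ∀ {m n} → fromℕ m ℚ.< fromℕ n → m < n
fromℕ-cancel-< lt = ≰⇒> λ n≤m → ℚ-<⇒≱ lt (fromℕ-mono-≤ n≤m)

-- Here `r` is x/c and `a` is y/d - x/c. The map `h` multiplies `r + b` by `c * d > 0`, hence is
-- strictly increasing, and it sends `0`, `a`, `1` to `x * d`, `y * c`, `(x + c) * d`. Bounds on `a`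
-- thus match the two halves of `Step`.
module _ {c x d y : ℕ} {r a : ℚ} (c>0 : 0 < c) (d>0 : 0 < d)
         (rc≡x : r ℚ.* fromℕ c ≡ fromℕ x) (y≡ : fromℕ y ≡ (r ℚ.+ a) ℚ.* fromℕ d) where

  private
    e : ℚ
    e = fromℕ c ℚ.* fromℕ d

    h : ℚ → ℚ
    h b = (r ℚ.+ b) ℚ.* e

    instance
      e-pos : ℚ.Positive e
      e-pos = ℚ.positive (subst (0ℚ ℚ.<_) (fromℕ-* c d)
        (fromℕ-mono-< (>-nonZero⁻¹ _ {{m*n≢0 c d {{>-nonZero c>0}} {{>-nonZero d>0}}}})))

      e-nonNeg : ℚ.NonNegative e
      e-nonNeg = ℚ.pos⇒nonNeg e

    h-mono-≤ : ∀ {b b′} → b ℚ.≤ b′ → h b ℚ.≤ h b′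
    h-mono-≤ le = ℚ.*-monoʳ-≤-nonNeg e (ℚ.+-monoʳ-≤ r le)

    h-mono-< : ∀ {b b′} → b ℚ.< b′ → h b ℚ.< h b′
    h-mono-< lt = ℚ.*-monoˡ-<-pos e (ℚ.+-monoʳ-< r lt)

    h0 : h 0ℚ ≡ fromℕ (x * d)
    h0 = begin
      (r ℚ.+ 0ℚ) ℚ.* e            ≡⟨ cong (ℚ._* e) (ℚ.+-identityʳ r) ⟩
      r ℚ.* e                     ≡⟨ ℚ.*-assoc r (fromℕ c) (fromℕ d) ⟨
      r ℚ.* fromℕ c ℚ.* fromℕ d   ≡⟨ cong (ℚ._* fromℕ d) rc≡x ⟩
      fromℕ x ℚ.* fromℕ d         ≡⟨ fromℕ-* x d ⟨
      fromℕ (x * d)               ∎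
      where open ≡-Reasoning

    ha : h a ≡ fromℕ (y * c)
    ha = begin
      (r ℚ.+ a) ℚ.* (fromℕ c ℚ.* fromℕ d) ≡⟨ cong ((r ℚ.+ a) ℚ.*_) (ℚ.*-comm (fromℕ c) (fromℕ d)) ⟩
      (r ℚ.+ a) ℚ.* (fromℕ d ℚ.* fromℕ c) ≡⟨ ℚ.*-assoc (r ℚ.+ a) (fromℕ d) (fromℕ c) ⟨
      (r ℚ.+ a) ℚ.* fromℕ d ℚ.* fromℕ c   ≡⟨ cong (ℚ._* fromℕ c) y≡ ⟨
      fromℕ y ℚ.* fromℕ c                 ≡⟨ fromℕ-* y c ⟨
      fromℕ (y * c)                       ∎
      where open ≡-Reasoning

    h1 : h 1ℚ ≡ fromℕ ((x + c) * d)
    h1 = begin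
      (r ℚ.+ 1ℚ) ℚ.* (fromℕ c ℚ.* fromℕ d)          ≡⟨ ℚ.*-assoc (r ℚ.+ 1ℚ) (fromℕ c) (fromℕ d) ⟨
      (r ℚ.+ 1ℚ) ℚ.* fromℕ c ℚ.* fromℕ d            ≡⟨ cong (ℚ._* fromℕ d) (ℚ.*-distribʳ-+ (fromℕ c) r 1ℚ) ⟩
      (r ℚ.* fromℕ c ℚ.+ 1ℚ ℚ.* fromℕ c) ℚ.* fromℕ d
        ≡⟨ cong (ℚ._* fromℕ d) (cong₂ ℚ._+_ rc≡x (ℚ.*-identityˡ (fromℕ c))) ⟩
      (fromℕ x ℚ.+ fromℕ c) ℚ.* fromℕ d             ≡⟨ cong (ℚ._* fromℕ d) (fromℕ-+ x c) ⟨
      fromℕ (x + c) ℚ.* fromℕ d                     ≡⟨ fromℕ-* (x + c) d ⟨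
      fromℕ ((x + c) * d)                           ∎
      where open ≡-Reasoning

  coordinate⇒step : 0ℚ ℚ.≤ a × a ℚ.< 1ℚ → Step c x d y
  coordinate⇒step (0≤a , a<1) =
      fromℕ-cancel-≤ (subst₂ ℚ._≤_ h0 ha (h-mono-≤ 0≤a))
    , fromℕ-cancel-< (subst₂ ℚ._<_ ha h1 (h-mono-< a<1))

  step⇒coordinate : Step c x d y → 0ℚ ℚ.≤ a × a ℚ.< 1ℚ
  step⇒coordinate (lo , hi) =
      ℚ.≮⇒≥ (λ a<0 → ℚ-<⇒≱ (h-mono-< a<0) (subst₂ ℚ._≤_ (sym h0) (sym ha) (fromℕ-mono-≤ lo)))
    , ℚ.≰⇒> (λ 1≤a → ℚ-<⇒≱ (subst₂ ℚ._<_ (sym ha) (sym h1) (fromℕ-mono-< hi)) (h-mono-≤ 1≤a))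

-- `r` is the sum of the coefficients already consumed, which makes the notion stable under passing
-- to tails. By `sum-v`, `r = 0` describes the lattice points with natural coordinates.
PrefixPoint : (ℕ → ℕ) → ℚ → ∀ {n} → Vec ℕ n → Set
PrefixPoint s r {n} l = ∃ λ (α : F.Vector ℚ n) →
    (∀ i → 0ℚ ℚ.≤ α i × α i ℚ.< 1ℚ)
  × (∀ j → fromℕ (lookup l j) ≡ (r ℚ.+ prefix α j) ℚ.* fromℕ (s (toℕ j)))

prefixPoint⇒chain : ∀ {s c x r n} (l : Vec ℕ n) → (∀ i → 0 < s i) → 0 < c →
  r ℚ.* fromℕ c ≡ fromℕ x → PrefixPoint s r l → Chain s c x l
prefixPoint⇒chain []      pos c>0 rc≡x _ = tt
prefixPoint⇒chain {s} {r = r} (y ∷ l) pos c>0 rc≡x (α , b , e) =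
    coordinate⇒step {r = r} c>0 (pos 0) rc≡x (e zero) (b zero)
  -- The head equation `e zero` says that the new partial sum `r + α zero`, times `s 0`, is `y`.
  , prefixPoint⇒chain {s ∘ suc} {r = r ℚ.+ α zero} l (pos ∘ suc) (pos 0) (sym (e zero))
      (α ∘ suc , b ∘ suc , λ j → trans (e (suc j))
        (cong (ℚ._* fromℕ (s (suc (toℕ j)))) (sym (ℚ.+-assoc r (α zero) (prefix (α ∘ suc) j)))))

chain⇒prefixPoint : ∀ {s c x r n} (l : Vec ℕ n) → (∀ i → 0 < s i) → 0 < c →
  r ℚ.* fromℕ c ≡ fromℕ x → Chain s c x l → PrefixPoint s r l
chain⇒prefixPoint []      pos c>0 rc≡x _ = (λ ()) , (λ ()) , λ ()
chain⇒prefixPoint {s} {r = r} (y ∷ l) pos c>0 rc≡x (st , ch) = cons (reciprocal (s 0) (pos 0))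
  where
  cons : (∃ λ d⁻¹ → fromℕ (s 0) ℚ.* d⁻¹ ≡ 1ℚ) → PrefixPoint s r (y ∷ l)
  cons (d⁻¹ , dd⁻¹≡1) = a F.∷ α , bounds , eqs
    where
    y/d : ℚ
    y/d = fromℕ y ℚ.* d⁻¹

    y/d*d≡y : y/d ℚ.* fromℕ (s 0) ≡ fromℕ y
    y/d*d≡y = trans (ℚ.*-assoc (fromℕ y) d⁻¹ (fromℕ (s 0)))
      (trans (cong (fromℕ y ℚ.*_) (trans (ℚ.*-comm d⁻¹ (fromℕ (s 0))) dd⁻¹≡1))
             (ℚ.*-identityʳ (fromℕ y)))

    tail : PrefixPoint (s ∘ suc) y/d l
    tail = chain⇒prefixPoint {s ∘ suc} {r = y/d} l (pos ∘ suc) (pos 0) y/d*d≡y ch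

    α = proj₁ tail
    b = proj₁ (proj₂ tail)
    e = proj₂ (proj₂ tail)

    -- The partial sum through this coordinate has to be `y/d`, so the coefficient is its increment
    -- over `r`.
    a : ℚ
    a = y/d ℚ.- r

    y≡ : fromℕ y ≡ (r ℚ.+ a) ℚ.* fromℕ (s 0)
    y≡ = sym (trans (cong (ℚ._* fromℕ (s 0)) (p+[q-p]≡q r y/d)) y/d*d≡y)

    bounds : ∀ i → 0ℚ ℚ.≤ (a F.∷ α) i × (a F.∷ α) i ℚ.< 1ℚ
    bounds zero    = step⇒coordinate {r = r} c>0 (pos 0) rc≡x y≡ st
    bounds (suc i) = b i

    eqs : ∀ j → fromℕ (lookup (y ∷ l) j) ≡ (r ℚ.+ prefix (a F.∷ α) j) ℚ.* fromℕ (s (toℕ j))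
    eqs zero    = y≡
    eqs (suc j) = trans (e j) (cong (ℚ._* fromℕ (s (suc (toℕ j))))
      (trans (cong (ℚ._+ prefix α j) (sym (p+[q-p]≡q r y/d))) (ℚ.+-assoc r a _)))

embed : ∀ {n} → Vec ℕ n → Vec ℤ.ℤ n
embed = Vec.map (λ x → ℤ.+ x)

embed-injective : ∀ {n} {l m : Vec ℕ n} → embed l ≡ embed m → l ≡ m
embed-injective {l = []}    {[]}    _ = refl
embed-injective {l = x ∷ l} {y ∷ m} e with Vec.∷-injective e
... | e₁ , e₂ = cong₂ _∷_ (ℤ.+-injective e₁) (embed-injective e₂)

lookup-embed : ∀ {n} (l : Vec ℕ n) j → fromℤ (lookup (embed l) j) ≡ fromℕ (lookup l j)
lookup-embed l j = cong fromℤ (Vec.lookup-map j _ l)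

latticePoint⇒chain : ∀ {s n} (l : Vec ℕ n) → (∀ i → 0 < s i) →
                     LatticePoint s (embed l) → Chain s 1 0 l
latticePoint⇒chain {s} l pos (α , b , e) = prefixPoint⇒chain {r = 0ℚ} l pos z<s refl
  (α , b , λ j → trans (sym (lookup-embed l j)) (trans (e j) (trans (sum-v s α j)
    (cong (ℚ._* fromℕ (s (toℕ j))) (sym (ℚ.+-identityˡ (prefix α j)))))))

chain⇒latticePoint : ∀ {s n} (l : Vec ℕ n) → (∀ i → 0 < s i) →
                     Chain s 1 0 l → LatticePoint s (embed l)
chain⇒latticePoint {s} l pos ch with chain⇒prefixPoint {r = 0ℚ} l pos z<s refl ch
... | α , b , e = α , b , λ j → trans (lookup-embed l j) (trans (e j)
  (trans (cong (ℚ._* fromℕ (s (toℕ j))) (ℚ.+-identityˡ (prefix α j))) (sym (sum-v s α j))))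

nonNegative⇒embed : ∀ {n} (l : Vec ℤ.ℤ n) → (∀ j → ℤ.+ 0 ℤ.≤ lookup l j) →
                    ∃ λ m → l ≡ embed m
nonNegative⇒embed []                _ = [] , refl
nonNegative⇒embed (ℤ.+ x ∷ l)      h with nonNegative⇒embed l (h ∘ suc)
... | m , refl = x ∷ m , refl
nonNegative⇒embed (ℤ.-[1+ x ] ∷ l) h with () ← h zero

-- Enumeration of chains by their last entry

m<[1+m/n]*n : ∀ m n .{{_ : NonZero n}} → m < suc (m / n) * n
m<[1+m/n]*n m n = subst (_< suc (m / n) * n) (sym (m≡m%n+[m/n]*n m n))
  (+-monoˡ-< (m / n * n) (m%n<n m n))

-- The value is `c` at 0 and `s k` at `suc k`; recursing along shifted sequences matches `Chain`.
prev : (ℕ → ℕ) → ℕ → ℕ → ℕ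
prev s c zero    = c
prev s c (suc n) = prev (s ∘ suc) (s 0) n

prev-pos : ∀ {s c} → (∀ i → 0 < s i) → 0 < c → ∀ n → 0 < prev s c n
prev-pos pos c>0 zero    = c>0
prev-pos pos c>0 (suc n) = prev-pos (pos ∘ suc) (pos 0) n

-- The default `x` is the coordinate preceding the vector, so `end x l` is always what the next
-- `Step` starts from.
end : ∀ {n} → ℕ → Vec ℕ n → ℕ
end x []      = x
end x (y ∷ l) = end y l

end-∷ʳ : ∀ {n} x (l : Vec ℕ n) y → end x (l ∷ʳ y) ≡ y
end-∷ʳ x []      y = refl
end-∷ʳ x (z ∷ l) y = end-∷ʳ z l y

last-embed : ∀ {n} x (l : Vec ℕ (suc n)) → ℤ.∣ last (embed l) ∣ ≡ end x l
last-embed x l with initLast l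
... | l′ , y , refl = trans
  (cong ℤ.∣_∣ (trans (cong last (Vec.map-∷ʳ _ y l′)) (Vec.last-∷ʳ (ℤ.+ y) (embed l′))))
  (sym (end-∷ʳ x l′ y))

-- `Chain` peels entries off the front, as the partial sums of coefficients do, whereas the count
-- recurs on the last entry; this lemma and its converse change ends.
chain-∷ʳ⁺ : ∀ {s c x n} (l : Vec ℕ n) {y} → Chain s c x l →
            Step (prev s c n) (end x l) (s n) y → Chain s c x (l ∷ʳ y)
chain-∷ʳ⁺ []      _         st = st , tt
chain-∷ʳ⁺ (z ∷ l) (st′ , ch) st = st′ , chain-∷ʳ⁺ l ch st

chain-∷ʳ⁻ : ∀ {s c x n} (l : Vec ℕ n) {y} → Chain s c x (l ∷ʳ y) →
            Chain s c x l × Step (prev s c n) (end x l) (s n) y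
chain-∷ʳ⁻ []      (st , _)   = tt , st
chain-∷ʳ⁻ (z ∷ l) (st′ , ch) with chain-∷ʳ⁻ l ch
... | ch′ , st = (st′ , ch′) , st

-- The list counterpart of `windowSum`; taking lengths turns one into the other.
windowConcat : ∀ {A : Set} → (ℕ → List A) → ℕ → ℕ → List A
windowConcat g t zero    = []
windowConcat g t (suc c) = g t ++ windowConcat g (suc t) c

length-windowConcat : ∀ {A : Set} (g : ℕ → List A) t c →
  length (windowConcat g t c) ≡ windowSum (length ∘ g) t c
length-windowConcat g t zero    = refl
length-windowConcat g t (suc c) =
  trans (length-++ (g t)) (cong (length (g t) +_) (length-windowConcat g (suc t) c))

∈-windowConcat⁺ : ∀ {A : Set} (g : ℕ → List A) {x j t} c →
  t ≤ j → j < t + c → x ∈ g j → x ∈ windowConcat g t c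
∈-windowConcat⁺ g {t = t} zero    t≤j j<t x∈ =
  contradiction t≤j (<⇒≱ (subst (_ <_) (+-identityʳ t) j<t))
∈-windowConcat⁺ g {j = j} {t} (suc c) t≤j j<t+c x∈ with m≤n⇒m<n∨m≡n t≤j
... | inj₂ refl = ∈-++⁺ˡ x∈
... | inj₁ t<j  = ∈-++⁺ʳ (g t) (∈-windowConcat⁺ g c t<j (subst (j <_) (+-suc t c) j<t+c) x∈)

∈-windowConcat⁻ : ∀ {A : Set} (g : ℕ → List A) {x} t c → x ∈ windowConcat g t c →
  ∃ λ j → t ≤ j × j < t + c × x ∈ g j
∈-windowConcat⁻ g t (suc c) x∈ with ∈-++⁻ (g t) x∈
... | inj₁ x∈g = t , ≤-refl , m<m+n t z<s , x∈g
... | inj₂ x∈w with ∈-windowConcat⁻ g (suc t) c x∈w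
...   | j , t<j , j<t+c , x∈g = j , <⇒≤ t<j , subst (j <_) (sym (+-suc t c)) j<t+c , x∈g

windowConcat-unique : ∀ {A : Set} {g : ℕ → List A} → (∀ j → Unique (g j)) →
  (∀ {x i j} → x ∈ g i → x ∈ g j → i ≡ j) → ∀ t c → Unique (windowConcat g t c)
windowConcat-unique u disj t zero    = []
windowConcat-unique {g = g} u disj t (suc c) =
  Unique.++⁺ (u t) (windowConcat-unique u disj (suc t) c) separate
  where
  separate : Disjoint (g t) (windowConcat g (suc t) c)
  separate (x∈g , x∈w) with ∈-windowConcat⁻ g (suc t) c x∈w
  ... | j , t<j , _ , x∈gj = <⇒≢ t<j (disj x∈g x∈gj)

∈-pad⁻ : ∀ {A : Set} c (g : ℕ → List A) {x} j → x ∈ pad [] c g j →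
         ∃ λ i → j ≡ c + i × x ∈ g i
∈-pad⁻ zero    g j       x∈ = j , refl , x∈
∈-pad⁻ (suc c) g (suc j) x∈ with ∈-pad⁻ c g j x∈
... | i , refl , x∈g = i , refl , x∈g

pad-unique : ∀ {A : Set} c {g : ℕ → List A} → (∀ j → Unique (g j)) → ∀ j → Unique (pad [] c g j)
pad-unique zero    u j       = u j
pad-unique (suc c) u zero    = []
pad-unique (suc c) u (suc j) = pad-unique c u j

module Chains (s : ℕ → ℕ) (pos : ∀ i → 0 < s i) (c : ℕ) (c>0 : 0 < c) where

  private instance
    s-nonZero : ∀ {n} → NonZero (s n)
    s-nonZero {n} = >-nonZero (pos n)

  threshold : ℕ → ℕ → ℕ
  threshold n k = k * prev s c n / s n

  threshold-mono : ∀ n {i j} → i ≤ j → threshold n i ≤ threshold n j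
  threshold-mono n i≤j = /-monoˡ-≤ (s n) (*-monoˡ-≤ (prev s c n) i≤j)

  -- The solutions x of Step form the window threshold − prev < x ≤ threshold;
  -- adding prev to x avoids truncated subtraction.
  step⇒window : ∀ n {x k} → Step (prev s c n) x (s n) k →
    let f = threshold n k; p = prev s c n in suc f ≤ p + x × p + x < suc f + p
  step⇒window n {x} {k} (lo , hi) =
      subst (threshold n k <_) (+-comm x (prev s c n)) (m<n*o⇒m/o<n hi)
    , subst (prev s c n + x <_) (+-comm (prev s c n) (suc (threshold n k))) (+-monoʳ-< (prev s c n) (s≤s
        (subst (_≤ threshold n k) (m*n/n≡m x (s n)) (/-monoˡ-≤ (s n) lo))))

  -- The floor satisfies `f * s n ≤ k * p < suc f * s n`; the window bounds supply `x ≤ f` and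
  -- `suc f ≤ p + x`.
  window⇒step : ∀ n {x k} → let f = threshold n k; p = prev s c n in
    suc f ≤ p + x → p + x < suc f + p → Step p x (s n) k
  window⇒step n {x} {k} lo hi =
      ≤-trans (*-monoˡ-≤ (s n) x≤f) (m/n*n≤m (k * prev s c n) (s n))
    , <-≤-trans (m<[1+m/n]*n (k * prev s c n) (s n))
        (*-monoˡ-≤ (s n) (subst (suc (threshold n k) ≤_) (+-comm (prev s c n) x) lo))
    where
    x≤f : x ≤ threshold n k
    x≤f = ≤-pred (+-cancelˡ-< (prev s c n) x (suc (threshold n k)) (subst (prev s c n + x <_) (+-comm (suc (threshold n k)) (prev s c n)) hi))

  -- Padding moves the chains ending in `x` to index `p + x`, where `p` is `prev s c n`. The window
  -- of length `p` from `suc (threshold n k)` on then holds exactly the admissible predecessors,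
  -- negative candidates falling on empty lists.
  chains : ∀ n → ℕ → List (Vec ℕ n)
  chains zero    zero    = [] ∷ []
  chains zero    (suc k) = []
  chains (suc n) k       = List.map (_∷ʳ k)
    (windowConcat (pad [] (prev s c n) (chains n)) (suc (threshold n k)) (prev s c n))

  chains-sound : ∀ n k {l} → l ∈ chains n k → Chain s c 0 l × end 0 l ≡ k
  chains-sound zero    zero {[]} _ = tt , refl
  chains-sound (suc n) k {l} l∈ with ∈-map⁻ (_∷ʳ k) l∈
  ... | l′ , l′∈ , refl with ∈-windowConcat⁻ (pad [] (prev s c n) (chains n)) (suc (threshold n k)) (prev s c n) l′∈
  ... | j , lo , hi , l′∈pad with ∈-pad⁻ (prev s c n) (chains n) j l′∈pad
  ... | x , refl , l′∈chains with chains-sound n x l′∈chains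
  ... | ch , refl = chain-∷ʳ⁺ l′ ch (window⇒step n {x} {k} lo hi) , end-∷ʳ 0 l′ k

  chains-complete : ∀ n (l : Vec ℕ n) → Chain s c 0 l → l ∈ chains n (end 0 l)
  chains-complete zero    [] _ = here refl
  chains-complete (suc n) l ch with initLast l
  ... | l′ , y , refl with chain-∷ʳ⁻ l′ ch
  ... | ch′ , st with step⇒window n {end 0 l′} {y} st
  ... | lo , hi rewrite end-∷ʳ 0 l′ y = ∈-map⁺ (_∷ʳ y)
    (∈-windowConcat⁺ (pad [] (prev s c n) (chains n)) (prev s c n) lo hi
      (subst (l′ ∈_) (sym (pad-+ [] (prev s c n) (chains n) (end 0 l′)))
        (chains-complete n l′ ch′)))

  -- Lists for different last entries are disjoint, because `chains-sound` recovers the index from a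
  -- member as its `end`.
  chains-unique : ∀ n k → Unique (chains n k)
  chains-unique zero    zero    = [] ∷ []
  chains-unique zero    (suc k) = []
  chains-unique (suc n) k       = Unique.map⁺ (λ {l} {m} → Vec.∷ʳ-injectiveˡ l m)
    (windowConcat-unique (pad-unique (prev s c n) (chains-unique n)) separate (suc (threshold n k)) (prev s c n))
    where
    separate : ∀ {l i j} → l ∈ pad [] (prev s c n) (chains n) i →
               l ∈ pad [] (prev s c n) (chains n) j → i ≡ j
    separate {i = i} {j} l∈i l∈j
      with ∈-pad⁻ (prev s c n) (chains n) i l∈i | ∈-pad⁻ (prev s c n) (chains n) j l∈j
    ... | x , refl , l∈x | y , refl , l∈y = cong (prev s c n +_)
      (trans (sym (proj₂ (chains-sound n x l∈x))) (proj₂ (chains-sound n y l∈y)))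

  chains-quasiConcave : ∀ n → QuasiConcave (λ k → length (chains n k))
  -- The sequence is 1, 0, 0, ...: at `j = 0` the left index is 0 as well, and for positive `j` the
  -- right index is positive, where the sequence vanishes.
  chains-quasiConcave zero {j = zero}  z≤n _ = inj₁ ≤-refl
  chains-quasiConcave zero {j = suc j} _ (s≤s _) = inj₂ z≤n
  chains-quasiConcave (suc n) =
    -- The new counts are window sums of the padded old ones, read at a starting point that is
    -- monotone in `k`.
    quasiConcave-cong (sym ∘ length-chains)
      (quasiConcave-∘ {f = λ k → suc (threshold n k)} (s≤s ∘ threshold-mono n)
        (quasiConcave-windowSum p (quasiConcave-pad p (chains-quasiConcave n))))
    where
    p : ℕ
    p = prev s c n

    length-chains : ∀ k → length (chains (suc n) k) ≡
      windowSum (pad 0 p (λ x → length (chains n x))) (suc (threshold n k)) p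
    length-chains k = trans (length-map (_∷ʳ k) (windowConcat (pad [] p (chains n)) (suc (threshold n k)) p))
      (trans (length-windowConcat (pad [] p (chains n)) (suc (threshold n k)) p)
             (windowSum-cong (pad-∘ length [] p (chains n)) (suc (threshold n k)) p))

-- The origin is always a lattice point, which makes the polynomial nonzero and gives it a degree.
zero-chain : ∀ {s c} → (∀ i → 0 < s i) → 0 < c → ∀ n → Chain s c 0 (replicate n 0)
zero-chain pos c>0 zero    = tt
zero-chain pos c>0 (suc n) =
    (z≤n , >-nonZero⁻¹ _ {{m*n≢0 _ _ {{>-nonZero c>0}} {{>-nonZero (pos 0)}}}})
  , zero-chain (pos ∘ suc) (pos 0) n

-- Duplicate-free lists with the same members are equal as bags, hence permutations of each other.
length-unique : ∀ {A : Set} {xs ys : List A} → Unique xs → Unique ys →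
  (∀ {x} → x ∈ xs → x ∈ ys) → (∀ {x} → x ∈ ys → x ∈ xs) → length xs ≡ length ys
length-unique u v to from = ↭-length (∼bag⇒↭ (unique∧set⇒bag u v (mk⇔ to from)))

-- Coefficients of `Q` as numbers of chains

module _ (s : ℕ → ℕ) (pos : ∀ i → 0 < s i) (m : ℕ) where

  open Chains s pos 1 z<s

  lastℕ : Vec ℤ.ℤ (suc m) → ℕ
  lastℕ l = ℤ.∣ last l ∣

  -- The count depends only on the set enumerated, so `E` may be arbitrary; `embed` matches chains
  -- with the lattice points in the filtered list.
  length-filter-last : (E : Enumeration (LatticePoint s {suc m})) → ∀ k →
    length (filter (λ l → lastℕ l ≟ k) (Enumeration.elements E)) ≡ length (chains (suc m) k)
  length-filter-last E k = trans
    (length-unique (Unique.filter⁺ last≟k unique)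
                   (Unique.map⁺ embed-injective (chains-unique (suc m) k)) to from)
    (length-map embed (chains (suc m) k))
    where
    open Enumeration E
    last≟k = λ l → lastℕ l ≟ k

    to : ∀ {l} → l ∈ filter last≟k elements → l ∈ List.map embed (chains (suc m) k)
    to {l} l∈ with ∈-filter⁻ last≟k {xs = elements} l∈
    ... | l∈elements , last≡k
      -- Lattice points have nonnegative coordinates, so each comes from a vector of natural
      -- numbers.
      with nonNegative⇒embed l (λ j → proj₁ (lattice-bounds s {l = l} (sound l∈elements) j))
    ... | l′ , refl = ∈-map⁺ embed
      (subst (λ k → l′ ∈ chains (suc m) k) (trans (sym (last-embed 0 l′)) last≡k)
        (chains-complete (suc m) l′ (latticePoint⇒chain l′ pos (sound l∈elements))))

    from : ∀ {l} → l ∈ List.map embed (chains (suc m) k) → l ∈ filter last≟k elements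
    from l∈ with ∈-map⁻ embed l∈
    ... | l′ , l′∈ , refl with chains-sound (suc m) k l′∈
    ... | ch , end≡k = ∈-filter⁺ last≟k (complete (chain⇒latticePoint l′ pos ch))
      (trans (last-embed 0 l′) end≡k)

  coeff-Q : ∀ k → coeff (Q s pos (suc m)) k ≡ length (chains (suc m) k)
  coeff-Q k = trans
    (coeff-sum-x^ lastℕ k (Enumeration.elements (latticePoints s pos (suc m))))
    (length-filter-last (latticePoints s pos (suc m)) k)

  origin : Vec ℕ (suc m)
  origin = replicate (suc m) 0

  Q-hasDegree : ∃ (HasDegree (Q s pos (suc m)))
  Q-hasDegree = hasDegree (Q s pos (suc m)) {end 0 origin} λ coeff≡0 →
    <⇒≢ (∈-length (chains-complete (suc m) origin (zero-chain {c = 1} pos z<s (suc m))))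
        (sym (trans (sym (coeff-Q (end 0 origin))) coeff≡0))

  Q-quasiConcave : QuasiConcave (coeff (Q s pos (suc m)))
  Q-quasiConcave = quasiConcave-cong (λ k → sym (coeff-Q k)) (chains-quasiConcave (suc m))

unimodal : ∀ p → ∃ (HasDegree p) → QuasiConcave (coeff p) → Unimodal p
unimodal p (d , deg) qc = d , deg , quasiConcave⇒unimodalSeq qc d

theorem1p6 : (s : ℕ → ℕ) (pos : ∀ i → 0 < s i) (n : ℕ) .{{_ : NonZero n}} →
    Unimodal (Q s pos n)
theorem1p6 s pos (suc m) =
  unimodal (Q s pos (suc m)) (Q-hasDegree s pos m) (Q-quasiConcave s pos m)
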